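{- Let $D_1,D_2$ be finite sets, $S_1\subseteq T_1\subseteq D_1^{r_1}$ and $S_2\subseteq T_2\subseteq D_2^{r_2}$, and write $\widetilde{T_1}=D_1^{r_1}\setminus(T_1\setminus S_1)$, $\widetilde{T_2}=D_2^{r_2}\setminus(T_2\setminus S_2)$. If $\mathrm{Pattern}(S_2,\widetilde{T_2})\subseteq \mathrm{Pattern}(S_1,\widetilde{T_1})$, then $\mathrm{NRD}(S_1\mid T_1,n) = O\big(n+\mathrm{NRD}(S_2\mid T_2,n)\big)$.
   Context: Conditional non-redundancy: for $S\subseteq T\subseteq D^r$, an instance $(X,Y)$ ($X$ a finite set of variables, $Y\subseteq X^r$) is a non-redundant instance of $\mathrm{CSP}(S\mid T)$ if for every $y\in Y$ there is $\sigma:X\to D$ with $\sigma(y')\in S$ for all $y'\in Y\setminus\{y\}$ and $\sigma(y)\in T\setminus S$ (with $\sigma$ applied componentwise); $\mathrm{NRD}(S\mid T,n)$ is the maximum $|Y|$ of such an instance with $|X|=n$. An $n$-ary polymorphism pattern over a set of variables $V$ is a set of pairs $((v_1,\dots,v_n),v)$ with $v_1,\dots,v_n,v\in V$ (patterns are taken over variables from a fixed countably infinite set). For a finite set $D$, $I_D(P)$ is the set of $n$-ary partial functions $f$ from $D^n$ to $D$ such that: for every $((v_1,\dots,v_n),v)\in P$ and every $g:\{v_1,\dots,v_n,v\}\to D$, the tuple $(g(v_1),\dots,g(v_n))$ is in the domain of $f$, and if $v\in\{v_1,\dots,v_n\}$ then $f(g(v_1),\dots,g(v_n))=g(v)$;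 and $f$ is undefined on all other tuples. A partial function $f$ preserves a pair $(S,T)$, $S,T\subseteq D^r$, if for all $s^{(1)},\dots,s^{(n)}\in S$ such that each $(s^{(1)}_i,\dots,s^{(n)}_i)$, $i\in[r]$, lies in the domain of $f$, the tuple $(f(s^{(1)}_1,\dots,s^{(n)}_1),\dots,f(s^{(1)}_r,\dots,s^{(n)}_r))$ lies in $T$. $\mathrm{Pattern}(S,T)$ is the set of all patterns $P$ (of any arity $n\ge1$) such that every $f\in I_D(P)$ preserves $(S,T)$. -}

module Defs where

open import Data.Nat using (ℕ; suc; _≤_)
open import Data.Fin using (Fin)
open import Data.Vec using (Vec; map; tabulate; lookup)
open import Data.Vec.Membership.Propositional using () renaming (_∈_ to _∈ᵥ_)
open import Data.List using (List; length)
open import Data.List.Membership.Propositional using (_∈_)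
open import Data.List.Relation.Unary.Unique.Propositional using (Unique)
open import Data.Maybe using (Maybe; just)
open import Data.Product using (Σ; ∃; _×_; _,_)
open import Relation.Nullary using (¬_)
open import Relation.Binary.PropositionalEquality using (_≡_; _≢_)

Rel : ℕ → ℕ → Set₁
Rel d r = Vec (Fin d) r → Set

Tilde : ∀ {d r} → Rel d r → Rel d r → Rel d r
Tilde S T t = ¬ (T t × ¬ S t)

-- An instance (X,Y) with X = Fin n; Y is a finite set of r-tuples of
-- variables, given as a duplicate-free list.
NonRedundant : ∀ {d r} → Rel d r → Rel d r → (n : ℕ) → List (Vec (Fin n) r) → Set
NonRedundant {d} S T n Y =
  Unique Y ×
  (∀ y → y ∈ Y →
     Σ (Fin n → Fin d) λ σ →
       (∀ y′ → y′ ∈ Y → y′ ≢ y → S (map σ y′)) ×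
       T (map σ y) × ¬ S (map σ y))

IsNRD : ∀ {d r} → Rel d r → Rel d r → ℕ → ℕ → Set
IsNRD {r = r} S T n m =
  (Σ (List (Vec (Fin n) r)) λ Y → NonRedundant S T n Y × length Y ≡ m) ×
  (∀ Y → NonRedundant S T n Y → length Y ≤ m)

-- A k-ary pattern over the countably infinite variable set ℕ:
-- a set of pairs ((v₁,…,v_k), v).
Pattern : ℕ → Set₁
Pattern k = Vec ℕ k × ℕ → Set

PFun : ℕ → ℕ → Set
PFun d k = Vec (Fin d) k → Maybe (Fin d)

InI : ∀ {d k} → Pattern k → PFun d k → Set
InI {d} {k} P f =
  (∀ vs v → P (vs , v) → (g : ℕ → Fin d) →
     (∃ λ e → f (map g vs) ≡ just e) ×
     (v ∈ᵥ vs → f (map g vs) ≡ just (g v))) ×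
  (∀ t e → f t ≡ just e →
     ∃ λ vs → ∃ λ v → P (vs , v) × ∃ λ (g : ℕ → Fin d) → t ≡ map g vs)

Preserves : ∀ {d r k} → PFun d k → Rel d r → Rel d r → Set
Preserves {d} {r} {k} f S T =
  (s : Fin k → Vec (Fin d) r) → (∀ j → S (s j)) →
  (t : Vec (Fin d) r) →
  (∀ i → f (tabulate (λ j → lookup (s j) i)) ≡ just (lookup t i)) →
  T t

InPattern : ∀ {d r} → Rel d r → Rel d r → (k : ℕ) → Pattern k → Set
InPattern {d} S T k P = (f : PFun d k) → InI P f → Preserves f S T

PatternIncl : ∀ {d₁ r₁ d₂ r₂} → Rel d₂ r₂ → Rel d₂ r₂ → Rel d₁ r₁ → Rel d₁ r₁ → Set₁
PatternIncl S₂ T₂ S₁ T₁ =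
  (k : ℕ) → (P : Pattern (suc k)) → InPattern S₂ T₂ (suc k) P → InPattern S₁ T₁ (suc k) P

{-# OPTIONS --safe #-}

-- For y ∈ Y let t be the violating tuple σ_y(y).  Either some maps h, h′ : D₁ → D₁
-- satisfy h(s_i) = h′(s_i′) for all s ∈ S₁ but h(t_i) ≠ h′(t_i′).  For fixed (i, i′) such y,
-- seen as edges from y_i to y_i′ in a bipartite graph on two copies of X, are all bridges
-- (h ∘ σ_y and h′ ∘ σ_y colour the vertices), so there are at most 2n of them.
-- Or there are no such maps, and then the pattern with rows ((s_i)_{s ∈ S₁}, t_i) has an
-- interpretation over D₁ violating (S₁, T̃₁).  Hence it has one over D₂ violating (S₂, T̃₂),
-- which amounts to positions j_i and maps g_i : D₁ → D₂ such that (g_i(s_{j_i}))_i is in S₂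
-- for all s ∈ S₁ and in T₂ ∖ S₂ for s = t.  Cutting X into blocks of size about n / r₂ and
-- fixing (j_i), (g_i) and the blocks of the y_{j_i}, the tuples (y_{j_i})_i form a
-- non-redundant instance of CSP(S₂ | T₂) on n variables.
-- Excluded middle is available because the final inequality is decidable and its constants
-- only depend on the sizes of the domains and the arities.
module Submission where

open import Defs
open import Data.Nat using (ℕ; zero; suc; _≤_; _<_; _+_; _*_; _^_; pred; z≤n; s≤s; >-nonZero; _≤?_)
open import Data.Nat.DivMod using (_/_; _%_; m≡m%n+[m/n]*n; m%n<n; m/n*n≤m; m≥n⇒m/n>0)
import Data.Nat.Properties as ℕ
open import Data.Fin using (Fin; zero; suc; toℕ; fromℕ<; inject≤; combine; remQuot; finToFun; funToFin;
  punchIn; punchOut; splitAt; _↑ˡ_; _↑ʳ_; _≟_)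
open import Data.Fin.Properties using (toℕ-inject≤; toℕ-fromℕ<; finToFun-funToFin; remQuot-combine; *↔×;
  punchIn-punchOut; splitAt-↑ˡ; splitAt-↑ʳ; sequence; any?)
open import Data.List using (List; []; _∷_; length; filter; allFin) renaming (map to mapₗ; lookup to lookupₗ)
open import Data.List.Membership.Propositional using (_∈_)
open import Data.List.Membership.Propositional.Properties using (∈-filter⁻; ∈-map⁻; ∈-lookup; ∈-allFin)
open import Data.List.Properties using (length-map; length-tabulate)
open import Data.List.Relation.Unary.All as All using (All; []; _∷_)
open import Data.List.Relation.Unary.AllPairs using ([]; _∷_)
open import Data.List.Relation.Unary.All.Properties using () renaming (map⁺ to All-map⁺)
open import Data.List.Relation.Unary.Any using (here; there)
open import Data.List.Relation.Unary.Unique.Propositional using (Unique)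
open import Data.List.Relation.Unary.Unique.Propositional.Properties using (allFin⁺; filter⁺)
open import Data.Maybe using (Maybe; just; nothing)
open import Data.Maybe.Properties using (just-injective)
open import Data.Product using (∃; ∃₂; _×_; _,_; proj₁; proj₂)
open import Data.Sum using (_⊎_; inj₁; inj₂; [_,_]′)
open import Data.Vec using (Vec; []; _∷_; map; tabulate; lookup)
open import Data.Vec.Functional using (updateAt)
open import Data.Vec.Functional.Properties using (updateAt-updates; updateAt-minimal)
open import Data.Vec.Membership.Propositional using () renaming (_∈_ to _∈ᵥ_)
open import Data.Vec.Membership.Propositional.Properties using (∈-tabulate⁺)
open import Data.Vec.Properties using (lookup-map; lookup∘tabulate; tabulate∘lookup; tabulate-∘; tabulate-cong)
open import Effect.Monad using (RawMonad)
open import Function using (_∘_; id; const; _↪_; mk↪; RightInverse)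
open import Function.Construct.Composition using (_↪-∘_)
open import Function.Construct.Symmetry using (↔-sym)
open import Function.Properties.Inverse using (↔⇒↪)
open import Relation.Binary.PropositionalEquality
open import Relation.Nullary using (¬_; Dec; yes; no; ¬?; contradiction)
open import Relation.Nullary.Decidable using (decidable-stable; ¬¬-excluded-middle)
open import Relation.Nullary.Negation using (¬¬-Monad)

-- Finite quantifiers under double negation

¬¬-Fin : ∀ {n} {P : Fin n → Set} → (∀ i → ¬ ¬ P i) → ¬ ¬ (∀ i → P i)
¬¬-Fin = sequence (RawMonad.rawApplicative ¬¬-Monad)

¬¬-Vec : ∀ {d n} {P : Vec (Fin d) n → Set} → (∀ v → ¬ ¬ P v) → ¬ ¬ (∀ v → P v)
¬¬-Vec {n = zero}  h k = h [] λ p → k λ { [] → p }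
¬¬-Vec {n = suc n} h k =
  ¬¬-Fin (λ a → ¬¬-Vec (λ v → h (a ∷ v))) λ p → k λ { (a ∷ v) → p a v }

-- Retractions of finite sets and cutting the variables into blocks

clamp : ∀ n → ℕ → Fin (suc n)
clamp n       zero    = zero
clamp zero    (suc _) = zero
clamp (suc n) (suc w) = suc (clamp n w)

clamp-toℕ : ∀ {n} (i : Fin (suc n)) → clamp n (toℕ i) ≡ i
clamp-toℕ         zero    = refl
clamp-toℕ {suc n} (suc i) = cong suc (clamp-toℕ i)

-- Interpretations of a pattern assign a value to every natural number, so an element named by `toℕ`
-- must be read back by a total map. The argument rules out `Fin 0`.
toℕ-retraction : ∀ {d} → Fin d → ∃ λ (g : ℕ → Fin d) → ∀ a → g (toℕ a) ≡ a
toℕ-retraction {suc d} _ = clamp d , clamp-toℕ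

Fin-↪ : ∀ {m n} → 0 < m → m ≤ n → Fin m ↪ Fin n
Fin-↪ {suc m} _ m≤n = mk↪ {to = λ i → inject≤ i m≤n} {from = clamp m ∘ toℕ}
  λ { {i} refl → trans (cong (clamp m) (toℕ-inject≤ i m≤n)) (clamp-toℕ i) }

-- With `q` the quotient of `n` by `suc r`, the remainder is below `suc r`, hence at most
-- `suc r * q` because `q` is positive. So `2 * suc r` blocks of size `q` cover `Fin n`, while
-- `suc r` of them still fit into it.
chunks : ∀ r n → suc r ≤ n →
  ∃ λ q → (Fin n ↪ (Fin (2 * suc r) × Fin q)) × ((Fin (suc r) × Fin q) ↪ Fin n)
chunks r n r<n =
  q , ↔⇒↪ *↔× ↪-∘ Fin-↪ (ℕ.≤-trans (s≤s z≤n) r<n) upper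
    , Fin-↪ (ℕ.≤-trans 0<q (ℕ.m≤n*m q (suc r))) lower ↪-∘ ↔⇒↪ (↔-sym *↔×)
  where
  q = n / suc r
  0<q : 0 < q
  0<q = m≥n⇒m/n>0 r<n
  lower : suc r * q ≤ n
  lower = subst (_≤ n) (ℕ.*-comm q (suc r)) (m/n*n≤m n (suc r))
  upper : n ≤ 2 * suc r * q
  upper = begin
    n                                ≡⟨ m≡m%n+[m/n]*n n (suc r) ⟩
    n % suc r + q * suc r            ≤⟨ ℕ.+-monoˡ-≤ _ (ℕ.<⇒≤ (m%n<n n (suc r))) ⟩
    suc r + q * suc r                ≤⟨ ℕ.+-monoˡ-≤ _ (ℕ.m≤n*m (suc r) q {{>-nonZero 0<q}}) ⟩
    q * suc r + q * suc r            ≡⟨ cong₂ _+_ (ℕ.*-comm q (suc r)) (ℕ.*-comm q (suc r)) ⟩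
    suc r * q + suc r * q            ≡⟨ ℕ.*-distribʳ-+ q (suc r) (suc r) ⟨
    (suc r + suc r) * q              ≡⟨ cong (λ x → (suc r + x) * q) (ℕ.+-identityʳ (suc r)) ⟨
    2 * suc r * q                    ∎
    where open ℕ.≤-Reasoning

-- Counting: classes of a list and bridges of a graph

length-filter-∁ : ∀ {A : Set} {P : A → Set} (P? : ∀ a → Dec (P a)) (L : List A) →
  length L ≡ length (filter P? L) + length (filter (¬? ∘ P?) L)
length-filter-∁ P? []      = refl
length-filter-∁ P? (a ∷ L) with P? a
... | yes _ = cong suc (length-filter-∁ P? L)
... | no  _ = trans (cong suc (length-filter-∁ P? L)) (sym (ℕ.+-suc _ _))

-- The classes `P k` may overlap; each element is filed under the class chosen by `cover`, and the
-- keys are then removed one at a time.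
pigeonhole : ∀ {A : Set} {K M} (P : Fin K → A → Set) → (∀ a → ∃ λ k → P k a) →
  (∀ k L → Unique L → (∀ {a} → a ∈ L → P k a) → length L ≤ M) →
  ∀ L → Unique L → length L ≤ K * M
pigeonhole {A} {K} {M} P cover fibre L uL =
  subst (λ l → length L ≤ l * M) (length-tabulate {n = K} id)
    (go (allFin K) L uL λ _ → ∈-allFin _)
  where
  κ : A → Fin K
  κ a = proj₁ (cover a)
  go : ∀ keys L → Unique L → (∀ {a} → a ∈ L → κ a ∈ keys) → length L ≤ length keys * M
  go []         []      _  _     = z≤n
  go []         (a ∷ L) _  keyed with () ← keyed (here refl)
  go (k ∷ keys) L       uL keyed = begin
    length L                                                    ≡⟨ length-filter-∁ k? L ⟩
    length (filter k? L) + length (filter (¬? ∘ k?) L)          ≤⟨ ℕ.+-mono-≤ here≤ there≤ ⟩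
    M + length keys * M                                         ∎
    where
    open ℕ.≤-Reasoning
    k? : ∀ a → Dec (κ a ≡ k)
    k? a = κ a ≟ k
    here≤ : length (filter k? L) ≤ M
    here≤ = fibre k _ (filter⁺ k? uL) λ {a} a∈ →
      subst (λ k → P k a) (proj₂ (∈-filter⁻ k? {xs = L} a∈)) (proj₂ (cover a))
    there≤ : length (filter (¬? ∘ k?) L) ≤ length keys * M
    there≤ = go keys _ (filter⁺ (¬? ∘ k?) uL) λ a∈ →
      let a∈L , κa≢k = ∈-filter⁻ (¬? ∘ k?) {xs = L} a∈ in strip (keyed a∈L) κa≢k
      where
      strip : ∀ {k′} → k′ ∈ (k ∷ keys) → k′ ≢ k → k′ ∈ keys
      strip (here eq)  ≢k = contradiction eq ≢k
      strip (there k∈) _  = k∈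

-- Every edge is a bridge, as witnessed by a vertex colouring for which it is the only
-- non-monochromatic edge; contracting an edge preserves this.
bridges-bound : ∀ {A C : Set} N (src dst : A → Fin N) (L : List A) → Unique L →
  (∀ {a} → a ∈ L → ∃ λ (c : Fin N → C) → c (src a) ≢ c (dst a) ×
     (∀ {b} → b ∈ L → b ≢ a → c (src b) ≡ c (dst b))) →
  length L ≤ N
bridges-bound N src dst [] _ _ = z≤n
bridges-bound zero src dst (e ∷ L) _ _ with () ← src e
bridges-bound {A} {C} (suc N) src dst (e ∷ L) (e∉L ∷ uL) bridge =
  s≤s (bridges-bound N (contract ∘ src) (contract ∘ dst) L uL bridge′)
  where
  u v : Fin (suc N)
  u = src e
  v = dst e
  u≢v : u ≢ v
  u≢v eq = let c , bi , _ = bridge (here refl) in bi (cong c eq)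
  -- Deletes `u` and renames it to `v`: `punchOut u≢v` is the name of `v` among the remaining
  -- vertices.
  contract : Fin (suc N) → Fin N
  contract w with u ≟ w
  ... | yes _  = punchOut u≢v
  ... | no u≢w = punchOut u≢w
  contract-colour : (c : Fin (suc N) → C) → c u ≡ c v → ∀ w → c (punchIn u (contract w)) ≡ c w
  contract-colour c cu≡cv w with u ≟ w
  ... | yes refl = trans (cong c (punchIn-punchOut u≢v)) (sym cu≡cv)
  ... | no u≢w   = cong c (punchIn-punchOut u≢w)
  bridge′ : ∀ {a} → a ∈ L → ∃ λ (c : Fin N → C) → c (contract (src a)) ≢ c (contract (dst a)) ×
    (∀ {b} → b ∈ L → b ≢ a → c (contract (src b)) ≡ c (contract (dst b)))
  bridge′ a∈L with c , bi , mono ← bridge (there a∈L) =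
    c ∘ punchIn u , (λ eq → bi (trans (sym (same _)) (trans eq (same _)))) ,
    λ b∈L b≢a → trans (same _) (trans (mono (there b∈L) b≢a) (sym (same _)))
    where
    -- The colouring for which `a` is the bridge gives both ends of `e` one colour, so it descends
    -- to the contracted graph.
    same : ∀ w → c (punchIn u (contract w)) ≡ c w
    same = contract-colour c (mono (here refl) (All.lookup e∉L a∈L))

-- Gadgets, separation and the canonical pattern

Gadget : ∀ {d₁ r₁ d₂ r₂} → Rel d₁ r₁ → Rel d₂ r₂ → Rel d₂ r₂ → Vec (Fin d₁) r₁ →
  (Fin r₂ → Fin r₁) → (Fin r₂ → Fin d₁ → Fin d₂) → Set
Gadget {d₁} {r₁} {d₂} {r₂} S₁ S₂ T₂ t j g =
  (∀ s → S₁ s → S₂ (image s)) × T₂ (image t) × ¬ S₂ (image t)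
  where
  image : Vec (Fin d₁) r₁ → Vec (Fin d₂) r₂
  image s = tabulate λ i → g i (lookup s (j i))

-- Codes of gadgets give back positions and maps only up to pointwise equality.
Gadget-resp-≗ : ∀ {d₁ r₁ d₂ r₂} {S₁ : Rel d₁ r₁} {S₂ T₂ : Rel d₂ r₂} {t j j′ g g′} →
  j ≗ j′ → (∀ i → g i ≗ g′ i) → Gadget S₁ S₂ T₂ t j g → Gadget S₁ S₂ T₂ t j′ g′
Gadget-resp-≗ {d₁} {r₁} {S₂ = S₂} {T₂} {t} {j} {j′} {g} {g′} j≗ g≗ (pS , pT , ¬pS) =
  (λ s S₁s → subst S₂ (image≡ s) (pS s S₁s)) , subst T₂ (image≡ t) pT , ¬pS ∘ subst S₂ (sym (image≡ t))
  where
  image≡ : (s : Vec (Fin d₁) r₁) → tabulate (λ i → g i (lookup s (j i))) ≡ tabulate (λ i → g′ i (lookup s (j′ i)))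
  image≡ s = tabulate-cong λ i → trans (g≗ i _) (cong (g′ i ∘ lookup s) (j≗ i))

Separated : ∀ {d r} → Rel d r → Vec (Fin d) r → Fin r → Fin r → Set
Separated {d} S t i i′ = ∃₂ λ (h h′ : Fin d → Fin d) →
  (∀ s → S s → h (lookup s i) ≡ h′ (lookup s i′)) × h (lookup t i) ≢ h′ (lookup t i′)

-- s lists the tuples of the relation, possibly with repetitions.
module CanonicalPattern {d r k} (s : Fin k → Vec (Fin d) r) (t : Vec (Fin d) r) where

  row : Fin r → Vec ℕ k
  row i = tabulate λ j → toℕ (lookup (s j) i)

  -- Elements of the domain serve as variables, named by `toℕ`, so a map `g` on the variables
  -- recodes the domain into another one.
  canonical : Pattern k
  canonical (vs , v) = ∃ λ i → vs ≡ row i × v ≡ toℕ (lookup t i)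

  lookup-map-row : ∀ {e} (g : ℕ → Fin e) i j → lookup (map g (row i)) j ≡ g (toℕ (lookup (s j) i))
  lookup-map-row g i j = trans (lookup-map j g (row i)) (cong g (lookup∘tabulate _ j))

  -- The partial function sending `map g (row i)` to `g` of the entry of `t` at `i` is an
  -- interpretation: the linking hypothesis makes it well defined. It carries the tuples `s` to `t`,
  -- which lies outside `Tilde S T`.
  canonical∉ : ∀ {S T : Rel d r} → (∀ j → S (s j)) → T t → ¬ S t →
    (∀ i i′ (h h′ : Fin d → Fin d) → (∀ j → h (lookup (s j) i) ≡ h′ (lookup (s j) i′)) →
       h (lookup t i) ≡ h′ (lookup t i′)) →
    ¬ InPattern S (Tilde S T) k canonical
  canonical∉ {S} {T} S-s Tt ¬St linked inP = ¬¬-Vec (λ x → ¬¬-excluded-middle) refute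
    where
    Covered : Vec (Fin d) k → Set
    Covered x = ∃₂ λ i (g : ℕ → Fin d) → x ≡ map g (row i)
    refute : ¬ (∀ x → Dec (Covered x))
    refute covered? = inP f (f-row-interp , f-covered) s S-s t f-s≡t (Tt , ¬St)
      where
      value : ∀ {x} → Dec (Covered x) → Maybe (Fin d)
      value (yes (i , g , _)) = just (g (toℕ (lookup t i)))
      value (no _)            = nothing
      f : PFun d k
      f x = value (covered? x)
      f-row : ∀ i g → f (map g (row i)) ≡ just (g (toℕ (lookup t i)))
      f-row i g with covered? (map g (row i))
      ... | no ¬c = contradiction (i , g , refl) ¬c
      -- The tuple may have been matched with another coordinate `i′` and map `g′`; equality of the
      -- two images is then the premise of `linked`.
      ... | yes (i′ , g′ , eq) = cong just (sym (linked i i′ (g ∘ toℕ) (g′ ∘ toℕ) λ j →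
              trans (sym (lookup-map-row g i j)) (trans (cong (λ x → lookup x j) eq) (lookup-map-row g′ i′ j))))
      f-row-interp : ∀ vs v → canonical (vs , v) → (g : ℕ → Fin d) →
        (∃ λ e → f (map g vs) ≡ just e) × (v ∈ᵥ vs → f (map g vs) ≡ just (g v))
      f-row-interp _ _ (i , refl , refl) g = (_ , f-row i g) , λ _ → f-row i g
      f-covered : ∀ x e → f x ≡ just e →
        ∃ λ vs → ∃ λ v → canonical (vs , v) × ∃ λ (g : ℕ → Fin d) → x ≡ map g vs
      f-covered x e fx with covered? x
      f-covered x e fx | yes (i , g , eq) = row i , _ , (i , refl , refl) , g , eq
      f-covered x e () | no _
      f-s≡t : ∀ i → f (tabulate λ j → lookup (s j) i) ≡ just (lookup t i)
      f-s≡t i with g , g-toℕ ← toℕ-retraction (lookup t i) = begin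
        f (tabulate λ j → lookup (s j) i)            ≡⟨ cong f (tabulate-cong λ j → g-toℕ _) ⟨
        f (tabulate λ j → g (toℕ (lookup (s j) i)))  ≡⟨ cong f (tabulate-∘ g _) ⟩
        f (map g (row i))                            ≡⟨ f-row i g ⟩
        just (g (toℕ (lookup t i)))                  ≡⟨ cong just (g-toℕ _) ⟩
        just (lookup t i)                            ∎
        where open ≡-Reasoning

  -- A violation by an interpretation `f` has every column in the domain of `f`, so each column is
  -- the image of some row under some `g`. As the output variable occurs in that row, `f` must
  -- return its image under `g`. These rows and maps form the gadget.
  canonical∉⇒gadget : ∀ {e r′} {S₁ : Rel d r} {S T : Rel e r′} →
    (∀ x → S₁ x → ∃ λ j → s j ≡ x) →
    (∀ i → ∃ λ j → lookup (s j) i ≡ lookup t i) →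
    ¬ InPattern S (Tilde S T) k canonical → ¬ ¬ ∃₂ (Gadget S₁ S T t)
  canonical∉⇒gadget {e} {r′} {S₁} {S} {T} complete t∈row notIn ¬gadget =
    notIn λ f (interp , covered) s′ S-s′ t′ f-s′≡t′ (Tt′ , ¬St′) →
      let
        cover : ∀ i → ∃₂ λ j (g : ℕ → Fin e) → tabulate (λ l → lookup (s′ l) i) ≡ map g (row j)
        cover i = let _ , _ , (j , vs≡ , _) , g , eq = covered _ _ (f-s′≡t′ i)
                  in j , g , trans eq (cong (map g) vs≡)
        j : Fin r′ → Fin r
        j i = proj₁ (cover i)
        g : Fin r′ → ℕ → Fin e
        g i = proj₁ (proj₂ (cover i))
        s′≡ : ∀ l → s′ l ≡ tabulate (λ i → g i (toℕ (lookup (s l) (j i))))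
        s′≡ l = trans (sym (tabulate∘lookup (s′ l))) (tabulate-cong λ i →
          trans (sym (lookup∘tabulate _ l))
            (trans (cong (λ x → lookup x l) (proj₂ (proj₂ (cover i)))) (lookup-map-row (g i) (j i) l)))
        t′≡ : t′ ≡ tabulate (λ i → g i (toℕ (lookup t (j i))))
        t′≡ = trans (sym (tabulate∘lookup t′)) (tabulate-cong λ i → just-injective
          (trans (sym (f-s′≡t′ i)) (trans (cong f (proj₂ (proj₂ (cover i))))
            (proj₂ (interp _ _ (j i , refl , refl) (g i)) (v∈row (j i))))))
      in ¬gadget (j , (λ i → g i ∘ toℕ) ,
           (λ x S₁x → let l , sl≡x = complete x S₁x in
             subst S (trans (s′≡ l) (cong (λ x → tabulate λ i → g i (toℕ (lookup x (j i)))) sl≡x)) (S-s′ l)) ,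
           subst T t′≡ Tt′ , ¬St′ ∘ subst S (sym t′≡))
    where
    v∈row : ∀ i → toℕ (lookup t i) ∈ᵥ row i
    v∈row i = let j , eq = t∈row i in
      subst (λ a → toℕ a ∈ᵥ row i) eq (∈-tabulate⁺ (λ j → toℕ (lookup (s j) i)) j)

-- The extra slot makes the arity positive, as patterns require; `s₀` also fills the slots of
-- vectors outside `S`.
enumerate : ∀ {d r} {S : Rel d r} → (∀ s → Dec (S s)) → ∃ S →
  ∃ λ (s : Fin (suc (d ^ r)) → Vec (Fin d) r) → (∀ j → S (s j)) × (∀ x → S x → ∃ λ j → s j ≡ x)
enumerate {d} {r} {S} S? (s₀ , Ss₀) = s , S-s , complete
  where
  vec : Fin (d ^ r) → Vec (Fin d) r
  vec j = tabulate (finToFun j)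
  vec-surjective : ∀ x → ∃ λ j → vec j ≡ x
  vec-surjective x = funToFin (lookup x) ,
    trans (tabulate-cong (finToFun-funToFin (lookup x))) (tabulate∘lookup x)
  choose : ∀ {x} → Dec (S x) → Vec (Fin d) r
  choose {x} (yes _) = x
  choose     (no _)  = s₀
  s : Fin (suc (d ^ r)) → Vec (Fin d) r
  s zero    = s₀
  s (suc j) = choose (S? (vec j))
  S-s : ∀ j → S (s j)
  S-s zero = Ss₀
  S-s (suc j) with S? (vec j)
  ... | yes Sx = Sx
  ... | no  _  = Ss₀
  complete : ∀ x → S x → ∃ λ j → s j ≡ x
  complete x Sx with j , refl ← vec-surjective x = suc j , choose≡ (S? (vec j))
    where
    choose≡ : (d : Dec (S (vec j))) → choose d ≡ vec j
    choose≡ (yes _)  = refl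
    choose≡ (no ¬Sx) = contradiction Sx ¬Sx

-- Without separation the canonical pattern is not in the pattern set over the first domain, so by
-- contraposition not in the one over the second. The double negation stays because this failure
-- yields no explicit interpretation.
gadget-exists : ∀ {d₁ r₁ d₂ r₂} {S₁ T₁ : Rel d₁ r₁} {S₂ T₂ : Rel d₂ r₂} →
  PatternIncl S₂ (Tilde S₂ T₂) S₁ (Tilde S₁ T₁) → (∀ s → Dec (S₁ s)) → ∃ S₁ →
  ∀ {t} → T₁ t → ¬ S₁ t → ¬ ∃₂ (Separated S₁ t) → ¬ ¬ ∃₂ (Gadget S₁ S₂ T₂ t)
gadget-exists {d₁} {r₁} {S₁ = S₁} incl S₁? S₁≠∅ {t} Tt ¬St ¬sep
  with s , S-s , complete ← enumerate S₁? S₁≠∅ =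
  canonical∉⇒gadget complete t∈row (canonical∉ S-s Tt ¬St linked ∘ incl _ canonical)
  where
  open CanonicalPattern s t
  linked : ∀ i i′ (h h′ : Fin d₁ → Fin d₁) → (∀ j → h (lookup (s j) i) ≡ h′ (lookup (s j) i′)) →
    h (lookup t i) ≡ h′ (lookup t i′)
  linked i i′ h h′ agree = decidable-stable (_ ≟ _) λ differ →
    ¬sep (i , i′ , h , h′ , (λ x Sx → let j , eq = complete x Sx in
      subst (λ x → h (lookup x i) ≡ h′ (lookup x i′)) eq (agree j)) , differ)
  -- Otherwise the identity and the map moving only t_i would separate t at (i, i).
  t∈row : ∀ i → ∃ λ j → lookup (s j) i ≡ lookup t i
  t∈row i with any? (λ j → lookup (s j) i ≟ lookup t i)
  ... | yes found = found
  ... | no ¬found = zero , sym (trans (linked i i id h′ λ j → sym (updateAt-minimal _ _ id λ eq → ¬found (j , eq)))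
                                      (updateAt-updates (lookup t i) id))
    where
    h′ : Fin d₁ → Fin d₁
    h′ = updateAt id (lookup t i) (const (lookup (s zero) i))

-- Transporting non-redundancy along a map of tuples

Unique⇒lookup-injective : ∀ {A : Set} {L : List A} → Unique L → ∀ {i j} → lookupₗ L i ≡ lookupₗ L j → i ≡ j
Unique⇒lookup-injective (_    ∷ _)  {zero}  {zero}  _  = refl
Unique⇒lookup-injective (a∉L ∷ _)  {zero}  {suc j} eq = contradiction eq (All.lookup a∉L (∈-lookup j))
Unique⇒lookup-injective (a∉L ∷ _)  {suc i} {zero}  eq = contradiction (sym eq) (All.lookup a∉L (∈-lookup i))
Unique⇒lookup-injective (_    ∷ uL) {suc i} {suc j} eq = cong suc (Unique⇒lookup-injective uL eq)

-- `z` is injective on `L`: if distinct `a` and `b` had one image, `τ a` would send it both into `S`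
-- and outside `S`.
nonRedundant-map : ∀ {A : Set} {d r n} {S T : Rel d r}
  (z : A → Vec (Fin n) r) (τ : A → Fin n → Fin d) {L : List A} → Unique L →
  (∀ {a b} → a ∈ L → b ∈ L → b ≢ a → S (map (τ a) (z b))) →
  (∀ {a} → a ∈ L → T (map (τ a) (z a)) × ¬ S (map (τ a) (z a))) →
  NonRedundant S T n (mapₗ z L)
nonRedundant-map {S = S} {T} z τ {L} uL off diag = unique uL off diag , witness
  where
  unique : ∀ {L} → Unique L →
    (∀ {a b} → a ∈ L → b ∈ L → b ≢ a → S (map (τ a) (z b))) →
    (∀ {a} → a ∈ L → T (map (τ a) (z a)) × ¬ S (map (τ a) (z a))) →
    Unique (mapₗ z L)
  unique []         _   _    = []
  unique (e∉L ∷ uL) off diag =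
    All-map⁺ (All.tabulate λ b∈ ze≡zb → proj₂ (diag (here refl))
      (subst (S ∘ map (τ _)) (sym ze≡zb) (off (here refl) (there b∈) (All.lookup e∉L b∈ ∘ sym))))
    ∷ unique uL (λ a∈ b∈ → off (there a∈) (there b∈)) (diag ∘ there)
  witness : ∀ y → y ∈ mapₗ z L → ∃ λ σ →
    (∀ y′ → y′ ∈ mapₗ z L → y′ ≢ y → S (map σ y′)) × T (map σ y) × ¬ S (map σ y)
  witness y y∈ with a , a∈ , refl ← ∈-map⁻ z y∈ = τ a , off′ , diag a∈
    where
    off′ : ∀ y′ → y′ ∈ mapₗ z L → y′ ≢ z a → S (map (τ a) y′)
    off′ y′ y′∈ y′≢ with b , b∈ , refl ← ∈-map⁻ z y′∈ = off a∈ b∈ (y′≢ ∘ cong z)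

-- Finite codes for gadgets

module Codes (r b d e r′ : ℕ) where

  -- For each coordinate a position, a block and a unary map, packed into one number, so that the
  -- number of classes is an explicit constant free of `n`.
  Code : Set
  Code = Fin ((r * (b * e ^ d)) ^ r′)

  pos : Code → Fin r′ → Fin r
  pos k i = proj₁ (remQuot (b * e ^ d) (finToFun k i))

  private
    rest : Code → Fin r′ → Fin b × Fin (e ^ d)
    rest k i = remQuot (e ^ d) (proj₂ (remQuot {r} (b * e ^ d) (finToFun k i)))

  block : Code → Fin r′ → Fin b
  block k i = proj₁ (rest k i)

  fun : Code → Fin r′ → Fin d → Fin e
  fun k i = finToFun (proj₂ (rest k i))

  encode : (j : Fin r′ → Fin r) (β : Fin r′ → Fin b) (g : Fin r′ → Fin d → Fin e) →
    ∃ λ k → pos k ≗ j × block k ≗ β × (∀ i → fun k i ≗ g i)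
  encode j β g = k , cong proj₁ ∘ outer , cong proj₁ ∘ inner ,
    λ i a → trans (cong (λ x → finToFun (proj₂ x) a) (inner i)) (finToFun-funToFin (g i) a)
    where
    w : Fin r′ → Fin (b * e ^ d)
    w i = combine (β i) (funToFin (g i))
    k : Code
    k = funToFin (λ i → combine (j i) (w i))
    outer : ∀ i → remQuot (b * e ^ d) (finToFun k i) ≡ (j i , w i)
    outer i = trans (cong (remQuot (b * e ^ d)) (finToFun-funToFin _ i)) (remQuot-combine (j i) (w i))
    inner : ∀ i → rest k i ≡ (β i , funToFin (g i))
    inner i = trans (cong (remQuot (e ^ d) ∘ proj₂) (outer i)) (remQuot-combine (β i) _)

-- Bounds for the separated tuples and for the gadget tuples

module Instance {d₁ r₁ n m} (S₁ : Rel d₁ r₁)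
  (y : Fin m → Vec (Fin n) r₁) (σ : Fin m → Fin n → Fin d₁)
  (off : ∀ {l l′} → l′ ≢ l → S₁ (map (σ l) (y l′))) where

  t : Fin m → Vec (Fin d₁) r₁
  t l = map (σ l) (y l)

  -- Two copies of the variables are used because one variable may stand at `i` in one tuple and at
  -- `i′` in another, where `h` and `h′` may colour it differently.
  separated-bound : ∀ i i′ L → Unique L → (∀ {l} → l ∈ L → Separated S₁ (t l) i i′) → length L ≤ n + n
  separated-bound i i′ L uL sep =
    bridges-bound (n + n) (λ l → lookup (y l) i ↑ˡ n) (λ l → n ↑ʳ lookup (y l) i′) L uL bridge
    where
    bridge : ∀ {l} → l ∈ L → ∃ λ (c : Fin (n + n) → Fin d₁) →
      c (lookup (y l) i ↑ˡ n) ≢ c (n ↑ʳ lookup (y l) i′) ×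
      (∀ {l′} → l′ ∈ L → l′ ≢ l → c (lookup (y l′) i ↑ˡ n) ≡ c (n ↑ʳ lookup (y l′) i′))
    bridge {l} l∈L with h , h′ , agree , differ ← sep l∈L =
      c , (λ eq → differ (trans (sym (left l)) (trans eq (right l)))) ,
      λ {l′} _ l′≢l → trans (left l′) (trans (agree _ (off l′≢l)) (sym (right l′)))
      where
      c : Fin (n + n) → Fin d₁
      c = [ h ∘ σ l , h′ ∘ σ l ]′ ∘ splitAt n
      left : ∀ l′ → c (lookup (y l′) i ↑ˡ n) ≡ h (lookup (map (σ l) (y l′)) i)
      left l′ = trans (cong [ h ∘ σ l , h′ ∘ σ l ]′ (splitAt-↑ˡ n _ n)) (cong h (sym (lookup-map i (σ l) (y l′))))
      right : ∀ l′ → c (n ↑ʳ lookup (y l′) i′) ≡ h′ (lookup (map (σ l) (y l′)) i′)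
      right l′ = trans (cong [ h ∘ σ l , h′ ∘ σ l ]′ (splitAt-↑ʳ n n _)) (cong h′ (sym (lookup-map i′ (σ l) (y l′))))

  -- Coordinate `i` of the new tuples uses its own part of the variables, a copy of block `β i`. The
  -- parts being disjoint, `τ l` can apply a different `g i` on each.
  gadget-bound : ∀ {d₂ r₂ b q m₂} {S₂ T₂ : Rel d₂ r₂} → ∃ S₁ →
    (spread : Fin n ↪ (Fin b × Fin q)) → ((Fin (suc (pred r₂)) × Fin q) ↪ Fin n) →
    (∀ Y → NonRedundant S₂ T₂ n Y → length Y ≤ m₂) →
    ∀ j (β : Fin r₂ → Fin b) g L → Unique L →
    (∀ {l} → l ∈ L → Gadget S₁ S₂ T₂ (t l) j g ×
       (∀ i → proj₁ (RightInverse.to spread (lookup (y l) (j i))) ≡ β i)) →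
    length L ≤ m₂
  gadget-bound {r₂ = zero} (s , S₁s) _ _ _ _ _ _ []      _ _ = z≤n
  -- In arity 0 the images of `s` and of the violating tuple are both the empty tuple, which cannot
  -- be in `S₂` and outside it.
  gadget-bound {r₂ = zero} (s , S₁s) _ _ _ _ _ _ (l ∷ L) _ fits =
    let (pS , _ , ¬pS) , _ = fits (here refl) in contradiction (pS s S₁s) ¬pS
  gadget-bound {d₂} {r₂@(suc _)} {b} {q} {m₂} {S₂} {T₂} _ spread pack max₂ j β g L uL fits =
    subst (_≤ m₂) (length-map z L) (max₂ _ (nonRedundant-map {S = S₂} {T₂} z τ uL
      (λ {l} {l′} l∈ l′∈ l′≢l → subst S₂ (sym (τz l l′∈)) (proj₁ (proj₁ (fits l′∈)) _ (off l′≢l)))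
      (λ {l} l∈ → let (_ , pT , ¬pS) , _ = fits l∈ in
        subst T₂ (sym (τz l l∈)) pT , ¬pS ∘ subst S₂ (τz l l∈))))
    where
    module spread = RightInverse spread
    module pack = RightInverse pack
    slot : Fin m → Fin r₂ → Fin n
    slot l i = pack.to (i , proj₂ (spread.to (lookup (y l) (j i))))
    z : Fin m → Vec (Fin n) r₂
    z l = tabulate (slot l)
    τ : Fin m → Fin n → Fin d₂
    -- A new variable in part `i` at offset `o` stands for the old variable at offset `o` of block
    -- `β i`.
    τ l w = let i , o = pack.from w in g i (σ l (spread.from (β i , o)))
    τz : ∀ l {l′} → l′ ∈ L → map (τ l) (z l′) ≡ tabulate λ i → g i (lookup (map (σ l) (y l′)) (j i))
    τz l {l′} l′∈ = trans (sym (tabulate-∘ (τ l) (slot l′))) (tabulate-cong λ i → begin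
      τ l (slot l′ i)
        ≡⟨ cong (λ (i , o) → g i (σ l (spread.from (β i , o)))) (pack.strictlyInverseʳ _) ⟩
      g i (σ l (spread.from (β i , proj₂ (spread.to (x i)))))
        -- The variable of `l′` at position `j i` lies in block `β i`, so its offset alone recovers
        -- it.
        ≡⟨ cong (λ β → g i (σ l (spread.from (β , proj₂ (spread.to (x i)))))) (proj₂ (fits l′∈) i) ⟨
      g i (σ l (spread.from (spread.to (x i))))
        ≡⟨ cong (g i ∘ σ l) (spread.strictlyInverseʳ _) ⟩
      g i (σ l (x i))
        ≡⟨ cong (g i) (lookup-map (j i) (σ l) (y l′)) ⟨
      g i (lookup (map (σ l) (y l′)) (j i)) ∎)
      where
      open ≡-Reasoning
      x : Fin r₂ → Fin n
      x i = lookup (y l′) (j i)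

-- Combining the bounds over all classes

theorem1p6 : ∀ {d₁ r₁ d₂ r₂} (S₁ T₁ : Rel d₁ r₁) (S₂ T₂ : Rel d₂ r₂) →
    (∀ t → S₁ t → T₁ t) → (∀ t → S₂ t → T₂ t) →
    PatternIncl S₂ (Tilde S₂ T₂) S₁ (Tilde S₁ T₁) →
    ∃₂ λ (C N₀ : ℕ) → ∀ n m₁ m₂ → N₀ ≤ n →
    IsNRD S₁ T₁ n m₁ → IsNRD S₂ T₂ n m₂ → m₁ ≤ C * (n + m₂)
theorem1p6 {d₁} {r₁} {d₂} {r₂} S₁ T₁ S₂ T₂ _ _ incl = suc K * 2 , suc (pred r₂) , bound
  where
  b K₁ K₂ K : ℕ
  -- `suc (pred r₂)` is `r₂` when that is positive and 1 otherwise, so the number of blocks is never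
  -- 0.
  b  = 2 * suc (pred r₂)
  K₁ = r₁ * r₁
  K₂ = (r₁ * (b * d₂ ^ d₁)) ^ r₂
  K  = K₁ + K₂
  open Codes r₁ b d₁ d₂ r₂
  bound : ∀ n m₁ m₂ → suc (pred r₂) ≤ n →
    IsNRD S₁ T₁ n m₁ → IsNRD S₂ T₂ n m₂ → m₁ ≤ suc K * 2 * (n + m₂)
  bound n m₁ m₂ r₂≤n ((Y , (uY , witness) , refl) , _) (_ , max₂) =
    subst (length Y ≤_) (sym (ℕ.*-assoc (suc K) 2 (n + m₂)))
      (decidable-stable (_ ≤? _) λ ¬bounded → ¬¬-excluded-middle λ
        { (no S₁=∅)  → ¬bounded (empty-bound S₁=∅)
        ; (yes S₁≠∅) → ¬¬-Vec (λ s → ¬¬-excluded-middle) λ S₁? →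
            ¬¬-Fin (alternative S₁≠∅ S₁?) λ alt → ¬bounded (main-bound S₁≠∅ alt) })
    where
    -- Bounds each single class: `n + n` for separated tuples and `m₂` for gadgets.
    M : ℕ
    M = 2 * (n + m₂)
    n+n≤M : n + n ≤ M
    n+n≤M = ℕ.+-mono-≤ (ℕ.m≤m+n n m₂) (ℕ.≤-trans (ℕ.m≤m+n n m₂) (ℕ.m≤m+n (n + m₂) 0))
    m₂≤M : m₂ ≤ M
    m₂≤M = ℕ.≤-trans (ℕ.m≤n+m m₂ n) (ℕ.m≤m+n (n + m₂) _)
    -- Tuples are indexed by `Fin m` so that `¬¬-Fin` can settle the alternative for all of them at
    -- once.
    m : ℕ
    m = length Y
    y : Fin m → Vec (Fin n) r₁
    y = lookupₗ Y
    σ : Fin m → Fin n → Fin d₁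
    σ l = proj₁ (witness (y l) (∈-lookup l))
    off : ∀ {l l′} → l′ ≢ l → S₁ (map (σ l) (y l′))
    off {l} {l′} l′≢l = proj₁ (proj₂ (witness (y l) (∈-lookup l))) (y l′) (∈-lookup l′)
      (l′≢l ∘ Unique⇒lookup-injective uY)
    open Instance S₁ y σ off

    -- Of two distinct tuples, the assignment of one would map the other into `S₁`. The successor in
    -- `suc K` leaves room for the single tuple even when `K` is 0.
    empty-bound : ¬ ∃ S₁ → m ≤ suc K * M
    empty-bound S₁=∅ = ℕ.≤-trans (at-most-one) (ℕ.≤-trans 1≤M (ℕ.m≤m+n M (K * M)))
      where
      1≤M : 1 ≤ M
      1≤M = ℕ.≤-trans (s≤s z≤n) (ℕ.≤-trans r₂≤n (ℕ.≤-trans (ℕ.m≤m+n n n) n+n≤M))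
      at-most-one : m ≤ 1
      at-most-one = ℕ.≮⇒≥ λ 1<m → S₁=∅ (_ , off {fromℕ< (ℕ.<⇒≤ 1<m)} {fromℕ< 1<m} λ eq →
        contradiction (trans (sym (toℕ-fromℕ< 1<m)) (trans (cong toℕ eq) (toℕ-fromℕ< (ℕ.<⇒≤ 1<m)))) λ ())

    alternative : ∃ S₁ → (∀ s → Dec (S₁ s)) → ∀ l →
      ¬ ¬ (∃₂ (Separated S₁ (t l)) ⊎ ∃₂ (Gadget S₁ S₂ T₂ (t l)))
    alternative S₁≠∅ S₁? l ¬alt = ¬¬-excluded-middle λ
      { (yes sep) → ¬alt (inj₁ sep)
      ; (no ¬sep) → let _ , _ , Tt , ¬St = witness (y l) (∈-lookup l) in
          gadget-exists incl S₁? S₁≠∅ Tt ¬St ¬sep (¬alt ∘ inj₂) }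

    main-bound : ∃ S₁ → (∀ l → ∃₂ (Separated S₁ (t l)) ⊎ ∃₂ (Gadget S₁ S₂ T₂ (t l))) → m ≤ suc K * M
    main-bound S₁≠∅ alt with q , spread , pack ← chunks (pred r₂) n r₂≤n =
      ℕ.≤-trans (subst (_≤ K * M) (length-tabulate {n = m} id)
                  (pigeonhole (λ k → [ Sep , Gad ]′ (splitAt K₁ k)) cover fibre (allFin m) (allFin⁺ m)))
                (ℕ.m≤n+m (K * M) M)
      where
      Sep : Fin K₁ → Fin m → Set
      Sep k l = Separated S₁ (t l) (proj₁ (remQuot {r₁} r₁ k)) (proj₂ (remQuot {r₁} r₁ k))
      Gad : Fin K₂ → Fin m → Set
      Gad k l = Gadget S₁ S₂ T₂ (t l) (pos k) (fun k) ×
        (∀ i → proj₁ (RightInverse.to spread (lookup (y l) (pos k i))) ≡ block k i)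
      cover : ∀ l → ∃ λ k → [ Sep , Gad ]′ (splitAt K₁ k) l
      cover l with alt l
      ... | inj₁ (i , i′ , sep) = combine i i′ ↑ˡ K₂ ,
        subst (λ k → [ Sep , Gad ]′ k l) (sym (splitAt-↑ˡ K₁ (combine i i′) K₂))
          (subst (λ (i , i′) → Separated S₁ (t l) i i′) (sym (remQuot-combine i i′)) sep)
      ... | inj₂ (j , g , gadget)
        with k , j≗ , β≗ , g≗ ← encode j (λ i → proj₁ (RightInverse.to spread (lookup (y l) (j i)))) g =
        K₁ ↑ʳ k ,
        subst (λ k → [ Sep , Gad ]′ k l) (sym (splitAt-↑ʳ K₁ K₂ k))
          (Gadget-resp-≗ {S₂ = S₂} {T₂} {t l} (sym ∘ j≗) (λ i → sym ∘ g≗ i) gadget ,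
           λ i → trans (cong (proj₁ ∘ RightInverse.to spread ∘ lookup (y l)) (j≗ i)) (sym (β≗ i)))
      fibre : ∀ k L → Unique L → (∀ {l} → l ∈ L → [ Sep , Gad ]′ (splitAt K₁ k) l) → length L ≤ M
      fibre k L uL with splitAt K₁ k
      ... | inj₁ k₁ = λ sep → ℕ.≤-trans (separated-bound _ _ L uL sep) n+n≤M
      ... | inj₂ k₂ = λ fits → ℕ.≤-trans
          (gadget-bound {S₂ = S₂} {T₂} S₁≠∅ spread pack max₂ (pos k₂) (block k₂) (fun k₂) L uL fits) m₂≤M
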